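{- There exist infinitely many pairwise non-isomorphic detour-saturated graphs of girth $6$, and there exists a detour-saturated graph of girth $7$ and order $30$.
   Context: All graphs are finite and simple. A detour of a graph $G$ is a longest path in $G$. The detour order $\tau(G)$ of $G$ is the number of vertices in a detour of $G$. A graph $G$ is detour-saturated if $\tau(G+e)>\tau(G)$ for every edge $e$ of the complement $\bar{G}$. The girth of a graph is the length of a shortest cycle in it. -}

module Defs where

open import Data.Nat using (ℕ; _<_; _≤_; _≥_)
open import Data.Fin using (Fin; _≟_)
open import Data.Bool using (Bool; T; _∨_; _∧_; not)
open import Data.List using (List; length)
import Data.List as List
open import Data.List.Relation.Unary.Unique.Propositional using (Unique)
open import Data.List.Relation.Unary.Linked using (Linked)
open import Data.Maybe using (Maybe; just; nothing)
open import Data.Product using (Σ; ∃; _×_; _,_)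
open import Relation.Binary.PropositionalEquality using (_≡_; _≢_)
open import Relation.Nullary using (¬_)
open import Relation.Nullary.Decidable using (⌊_⌋)
open import Function.Bundles using (_↔_; Inverse)
open import Data.Empty using (⊥)
open import Data.Unit using (⊤)

record Graph (n : ℕ) : Set where
  field
    adj   : Fin n → Fin n → Bool
    sym   : ∀ x y → adj x y ≡ adj y x
    irrefl : ∀ x → adj x x ≡ Data.Bool.false
open Graph public

Adj : ∀ {n} → Graph n → Fin n → Fin n → Set
Adj G x y = T (adj G x y)

record Path {n : ℕ} (G : Graph n) : Set where
  field
    verts    : List (Fin n)
    distinct : Unique verts
    linked   : Linked (Adj G) verts
open Path public

order : ∀ {n} {G : Graph n} → Path G → ℕ
order P = length (verts P)

addEdgeAdj : ∀ {n} → Graph n → Fin n → Fin n → Fin n → Fin n → Bool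
addEdgeAdj G u v x y =
  adj G x y ∨ ((⌊ x ≟ u ⌋ ∧ ⌊ y ≟ v ⌋) ∨ (⌊ x ≟ v ⌋ ∧ ⌊ y ≟ u ⌋))

open import Data.Bool.Properties using (∨-comm)
open import Relation.Binary.PropositionalEquality using (cong₂; refl; sym; trans; cong)
open import Data.Bool using (true; false)
open import Relation.Nullary using (yes; no)

private
  irr-new : ∀ {n} (u v x : Fin n) → u ≢ v →
            ((⌊ x ≟ u ⌋ ∧ ⌊ x ≟ v ⌋) ∨ (⌊ x ≟ v ⌋ ∧ ⌊ x ≟ u ⌋)) ≡ false
  irr-new u v x u≢v with x ≟ u | x ≟ v
  ... | yes refl | yes refl = Data.Empty.⊥-elim (u≢v refl)
  ... | yes _ | no _ = refl
  ... | no _ | yes _ = refl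
  ... | no _ | no _ = refl

  sym-new : ∀ {n} (u v x y : Fin n) →
            ((⌊ x ≟ u ⌋ ∧ ⌊ y ≟ v ⌋) ∨ (⌊ x ≟ v ⌋ ∧ ⌊ y ≟ u ⌋)) ≡
            ((⌊ y ≟ u ⌋ ∧ ⌊ x ≟ v ⌋) ∨ (⌊ y ≟ v ⌋ ∧ ⌊ x ≟ u ⌋))
  sym-new u v x y with x ≟ u | y ≟ v | x ≟ v | y ≟ u
  ... | a | b | c | d = trans (∨-comm (⌊ a ⌋ ∧ ⌊ b ⌋) (⌊ c ⌋ ∧ ⌊ d ⌋))
                              (cong₂ _∨_ (Data.Bool.Properties.∧-comm ⌊ c ⌋ ⌊ d ⌋)
                                         (Data.Bool.Properties.∧-comm ⌊ a ⌋ ⌊ b ⌋))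

addEdge : ∀ {n} (G : Graph n) (u v : Fin n) → u ≢ v → Graph n
addEdge G u v u≢v = record
  { adj = addEdgeAdj G u v
  ; sym = λ x y → cong₂ _∨_ (Graph.sym G x y) (sym-new u v x y)
  ; irrefl = λ x → cong₂ _∨_ (Graph.irrefl G x) (irr-new u v x u≢v)
  }

DetourOrderGreater : ∀ {n} → Graph n → Graph n → Set
DetourOrderGreater H G = Σ (Path H) λ P → ∀ (Q : Path G) → order Q < order P

DetourSaturated : ∀ {n} → Graph n → Set
DetourSaturated {n} G = ∀ (u v : Fin n) → (u≢v : u ≢ v) → ¬ Adj G u v →
                        DetourOrderGreater (addEdge G u v u≢v) G

lastOf : ∀ {A : Set} → A → List A → A
lastOf x List.[] = x
lastOf x (y List.∷ ys) = lastOf y ys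

record Cycle {n : ℕ} (G : Graph n) : Set where
  field
    start    : Fin n
    rest     : List (Fin n)
    distinct : Unique (start List.∷ rest)
    linked   : Linked (Adj G) (start List.∷ rest)
    closes   : Adj G (lastOf start rest) start
    long     : 3 ≤ length (start List.∷ rest)

cycleLength : ∀ {n} {G : Graph n} → Cycle G → ℕ
cycleLength C = length (Cycle.start C List.∷ Cycle.rest C)

HasGirth : ∀ {n} → Graph n → ℕ → Set
HasGirth G g = Σ (Cycle G) (λ C → cycleLength C ≡ g)
             × (∀ (C : Cycle G) → g ≤ cycleLength C)

Isomorphic : ∀ {n m} → Graph n → Graph m → Set
Isomorphic {n} {m} G H = Σ (Fin n ↔ Fin m) λ f →
  ∀ x y → adj G x y ≡ adj H (Inverse.to f x) (Inverse.to f y)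

record AnyGraph : Set where
  constructor ⟨_,_⟩
  field
    ord : ℕ
    graph : Graph ord

-- Take a nonhamiltonian cubic graph on 28 vertices and replace one vertex by three leaves, one for
-- each of its neighbours. A path on 29 of the resulting 30 vertices would have to run from leaf to
-- leaf through all 27 other vertices, and so would close up to a Hamiltonian cycle of the cubic
-- graph. For the Coxeter graph (girth 7) and the flower snark J₇ (girth 6) the detour order of the
-- result is 28, and every new edge creates a path on 29 vertices.
-- A disjoint union of copies of a detour-saturated graph is detour-saturated as soon as every vertex
-- starts a path on more than half as many vertices as a detour: an edge between two copies joins two
-- such paths. The copies of the second graph give the infinite family.

module Submission where

open import Defs
open import Data.Nat using (ℕ)
open import Data.Product using (_×_; Σ)
open import Relation.Binary.PropositionalEquality using (_≢_)
open import Relation.Nullary using (¬_)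

open import Data.Bool using (Bool; true; false; T; if_then_else_; _∧_; _∨_)
import Data.Bool.Properties as Bool
open import Data.Empty using (⊥)
open import Data.Fin using (Fin; combine; quotient; remainder; toℕ)
import Data.Fin as Fin
import Data.Fin.Properties as Fin
open import Data.Fin.Permutation using (↔⇒≡)
open import Data.Fin.Subset using (Subset; ⊤; ⁅_⁆; ∣_∣; _-_) renaming (_∈_ to _∈ₛ_)
open import Data.Fin.Subset.Properties
  using (∈⊤; ∣⊤∣≡n; p─q⊆p; x∈p⇒∣p-x∣<∣p∣; x∈p∧x≢y⇒x∈p-y) renaming (_∈?_ to _∈ₛ?_)
open import Data.List using (List; []; _∷_; _++_; _ʳ++_; [_]; allFin; deduplicate; drop; filter; head; length; lookup; map; upTo)
open import Data.List.Properties using (length-ʳ++; length-map)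
open import Data.List.Membership.Propositional using (_∈_; _∉_)
import Data.List.Membership.DecPropositional
open import Data.List.Membership.Propositional.Properties using (∈-filter⁺; ∈-lookup; ∈-map⁻)
open import Data.List.Relation.Binary.Disjoint.Propositional using (Disjoint)
open import Data.List.Relation.Unary.All as All using (All; []; _∷_)
import Data.List.Relation.Unary.All.Properties as All
open import Data.List.Relation.Unary.AllPairs using ([]; _∷_)
open import Data.List.Relation.Unary.Any using (Any; here; there; any?; satisfied)
open import Data.List.Relation.Unary.Linked as Linked using (Linked; []; _∷_)
import Data.List.Relation.Unary.Linked.Properties as Linked
open import Data.List.Relation.Unary.Unique.Propositional using (Unique)
import Data.List.Relation.Unary.Unique.Propositional.Properties as Unique
import Data.List.Relation.Unary.Unique.DecPropositional
import Data.List.Relation.Unary.Unique.DecPropositional.Properties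
open import Data.Maybe using (fromMaybe)
open import Data.Nat using (zero; suc; _+_; _*_; _≤_; _<_; _≤?_; _<?_; z≤n; s≤s; s≤s⁻¹; _/_)
open import Data.Nat.DivMod using (_mod_)
import Data.Nat.Properties as ℕ
open import Data.Product using (∃; ∃₂; _,_; proj₁; proj₂)
open import Data.Sum as Sum using (_⊎_; inj₁; inj₂)
open import Data.Unit using () renaming (⊤ to Unit)
open import Data.Vec using (Vec)
import Data.Vec as Vec
open import Function using (_∘_)
open import Function.Bundles using (_⇔_; mk⇔)
open import Relation.Binary.Definitions using (Symmetric; tri<; tri≈; tri>)
open import Relation.Binary.PropositionalEquality using (_≡_; refl; cong; cong₂; trans; subst) renaming (sym to ≡-sym)
open import Relation.Nullary using (Dec; yes; no; does; contradiction)
open import Relation.Nullary.Decidable using (¬?; T?; _×-dec_; _⊎-dec_; _→-dec_; dec-true; does-⇔; isYes≗does; ⌊_⌋)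

-- Lists without repetition, linked lists and finite subsets.

module Member {n} = Data.List.Membership.DecPropositional (Fin._≟_ {n})
module Distinct {n} = Data.List.Relation.Unary.Unique.DecPropositional (Fin._≟_ {n})
module Dedup {n} = Data.List.Relation.Unary.Unique.DecPropositional.Properties (Fin._≟_ {n})

-- Unlike toWitness, this takes evidence that is checked with a single evaluation of P?.
holds : ∀ {P : Set} (P? : Dec P) → does P? ≡ true → P
holds (yes p) _ = p

at-most-one : ∀ {A : Set} {xs : List A} {x y} → length xs ≤ 1 → x ∈ xs → y ∈ xs → x ≡ y
at-most-one {xs = _ ∷ []}    _       (here refl) (here refl) = refl
at-most-one {xs = _ ∷ _ ∷ _} (s≤s ()) _ _

∉⇒All≢ : ∀ {A : Set} {x : A} {xs} → x ∉ xs → All (x ≢_) xs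
∉⇒All≢ = All.¬Any⇒All¬ _

-- `ʳ++` turns the first list round, so that its head meets the head of the second across `R x y`.
-- This joins two paths by an edge between their starting points.
Linked-ʳ++ : ∀ {A : Set} {R : A → A → Set} → Symmetric R → ∀ {x y} xs {ys} → R x y →
             Linked R (x ∷ xs) → Linked R (y ∷ ys) → Linked R ((x ∷ xs) ʳ++ (y ∷ ys))
Linked-ʳ++ R-sym []       xy _        l′ = xy ∷ l′
Linked-ʳ++ R-sym (_ ∷ xs) xy (r ∷ l) l′ = Linked-ʳ++ R-sym xs (R-sym r) l (xy ∷ l′)

Unique-ʳ++ : ∀ {A : Set} {xs ys : List A} →
             Unique xs → Unique ys → Disjoint xs ys → Unique (xs ʳ++ ys)
Unique-ʳ++ []        u′ _ = u′
Unique-ʳ++ (x≢ ∷ u) u′ d =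
  Unique-ʳ++ u (∉⇒All≢ (λ x∈ys → d (here refl , x∈ys)) ∷ u′)
    λ { (x∈xs , here refl) → All.lookup x≢ x∈xs refl ; (v∈xs , there v∈ys) → d (there v∈xs , v∈ys) }

Unique-length : ∀ {n} {S : Subset n} {xs} → Unique xs → All (_∈ₛ S) xs → length xs ≤ ∣ S ∣
Unique-length []       []         = z≤n
Unique-length {S = S} {x ∷ xs} (x≢ ∷ u) (x∈ ∷ xs∈) =
  ℕ.≤-<-trans (Unique-length u (All.zipWith (λ (y∈ , x≢y) → x∈p∧x≢y⇒x∈p-y y∈ (x≢y ∘ ≡-sym)) (xs∈ , x≢)))
    (x∈p⇒∣p-x∣<∣p∣ x∈)

x∉p-x : ∀ {n} (p : Subset n) x → ¬ x ∈ₛ p - x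
x∉p-x (_ Vec.∷ p) Fin.zero    ()
x∉p-x (_ Vec.∷ p) (Fin.suc x) (Vec.there x∈) = x∉p-x p x x∈

-- Paths confined to a set of free vertices.

Adj-sym : ∀ {n} (G : Graph n) → Symmetric (Adj G)
Adj-sym G {x} {y} = subst T (Graph.sym G x y)

-- The current vertex `c` still belongs to `S` and is deleted only when the path moves on, so `c`
-- counts as a free neighbour in `Dead`.
record Trail {n} (G : Graph n) (S : Subset n) (c : Fin n) (xs : List (Fin n)) : Set where
  constructor trail
  field
    linked : Linked (Adj G) (c ∷ xs)
    unique : Unique (c ∷ xs)
    inside : All (_∈ₛ S) (c ∷ xs)

Trail-tail : ∀ {n} {G : Graph n} {S c y xs} → Trail G S c (y ∷ xs) →
             Adj G c y × Trail G (S - c) y xs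
Trail-tail (trail (cy ∷ l) (c≢ ∷ u) (_ ∷ i)) =
  cy , trail l u (All.zipWith (λ (x∈ , c≢x) → x∈p∧x≢y⇒x∈p-y x∈ (c≢x ∘ ≡-sym)) (i , c≢))

-- A vertex strictly inside a path has a predecessor and a successor, and these differ because the
-- path repeats no vertex.
inner-neighbours : ∀ {n} {G : Graph n} {S c w xs} → Trail G S c xs → w ∈ xs →
  w ≡ lastOf c xs ⊎
  ∃₂ λ p q → p ∈ c ∷ xs × q ∈ c ∷ xs × p ≢ q × Adj G p w × Adj G w q
inner-neighbours {xs = _ ∷ []} _ (here refl) = inj₁ refl
inner-neighbours {xs = _ ∷ _ ∷ _} (trail (cw ∷ wq ∷ _) ((_ ∷ c≢q ∷ _) ∷ _) _) (here refl) =
  inj₂ (_ , _ , here refl , there (there (here refl)) , c≢q , cw , wq)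
inner-neighbours {xs = _ ∷ _} t (there w∈) =
  Sum.map₂ (λ (p , q , p∈ , q∈ , rest) → p , q , there p∈ , there q∈ , rest)
    (inner-neighbours (proj₂ (Trail-tail t)) w∈)

-- Exhaustive search for long paths and short cycles.

module Search {n} (nbrs : Fin n → List (Fin n)) where

  -- A path that starts at c and stays in S can visit such a w only as its last vertex.
  Dead : Subset n → Fin n → Fin n → Set
  Dead S c w = w ∈ₛ S × w ≢ c × length (filter (_∈ₛ? S) (nbrs w)) ≤ 1

  dead? : ∀ S c w → Dec (Dead S c w)
  dead? S c w = w ∈ₛ? S ×-dec ¬? (w Fin.≟ c) ×-dec (_ ≤? 1)

  -- Repetitions are removed because `Bounded` only counts the length of the list.
  dead : Subset n → Fin n → List (Fin n) → List (Fin n)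
  dead S c ws = deduplicate Fin._≟_ (filter (dead? S c) ws)

  mutual
    -- A certificate that paths from c inside S have at most k vertices, for ∣ S ∣ ≤ 2 + k and
    -- ws listing distinct dead vertices. Three of these suffice, as every path misses two of them.
    Bounded : ℕ → Subset n → Fin n → List (Fin n) → Set
    Bounded k S c ws = 3 ≤ length ws ⊎ Branches k S c ws

    Branches : ℕ → Subset n → Fin n → List (Fin n) → Set
    -- With bound 0 the vertex `c` alone is already one too many.
    Branches zero    S c ws = ⊥
    -- Deleting `c` lowers the free degree of its neighbours only, so every vertex dead after the
    -- step was dead before or is in `nbrs c`. There is no need to scan all vertices again.
    Branches (suc k) S c ws = Extensions k (S - c) (ws ++ nbrs c) (nbrs c)

    Extensions : ℕ → Subset n → List (Fin n) → List (Fin n) → Set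
    Extensions k S ws = All (λ y → y ∈ₛ S → Bounded k S y (dead S y ws))

  mutual
    bounded? : ∀ k S c ws → Dec (Bounded k S c ws)
    bounded? k S c ws = 3 ≤? length ws ⊎-dec branches? k S c ws

    branches? : ∀ k S c ws → Dec (Branches k S c ws)
    branches? zero    S c ws = no λ ()
    branches? (suc k) S c ws = extensions? k (S - c) (ws ++ nbrs c) (nbrs c)

    extensions? : ∀ k S ws ys → Dec (Extensions k S ws ys)
    extensions? k S ws = All.all? λ y → y ∈ₛ? S →-dec bounded? k S y (dead S y ws)

  -- The vertex `c` itself is not tested for adjacency to `s`: in `NoCycle` it starts as the
  -- neighbour through which the cycle leaves `s`.
  NoReturn : Fin n → ℕ → Subset n → Fin n → Set
  NoReturn s zero    S c = Unit
  NoReturn s (suc k) S c =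
    All (λ y → y ∈ₛ S - c → s ∉ nbrs y × NoReturn s k (S - c) y) (nbrs c)

  noReturn? : ∀ s k S c → Dec (NoReturn s k S c)
  noReturn? s zero    S c = yes _
  noReturn? s (suc k) S c = All.all?
    (λ y → y ∈ₛ? (S - c) →-dec (¬? (s Member.∈? nbrs y) ×-dec noReturn? s k (S - c) y)) (nbrs c)

  -- Excludes cycles s, y, … of length 3 to 2 + k: the bound k counts the vertices after y.
  NoCycle : ℕ → Set
  NoCycle k = ∀ s → All (NoReturn s k (⊤ - s)) (nbrs s)

  noCycle? : ∀ k → Dec (NoCycle k)
  noCycle? k = Fin.all? λ s → All.all? (noReturn? s k (⊤ - s)) (nbrs s)

  -- At each vertex, the next digit of code (in mixed radix, least significant first) selects one of
  -- the free neighbours.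
  walk : ℕ → ℕ → Subset n → List (Fin n) → List (Fin n)
  walk zero    code S ws = []
  walk (suc k) code S ws with filter (_∈ₛ? S) ws
  ... | []         = []
  ... | ys@(_ ∷ _) = y ∷ walk k (code / length ys) (S - y) (nbrs y)
    where y = lookup ys (code mod length ys)

  -- Each chosen vertex is deleted from `S`, so every code gives distinct vertices. Only adjacency
  -- and length of a decoded path remain to be evaluated.
  walk-unique : ∀ k code S ws → Unique (walk k code S ws) × All (_∈ₛ S) (walk k code S ws)
  walk-unique zero    code S ws = [] , []
  walk-unique (suc k) code S ws with filter (_∈ₛ? S) ws | All.all-filter (_∈ₛ? S) ws
  ... | []         | _   = [] , []
  ... | ys@(_ ∷ _) | all with lookup ys (code mod length ys) | All.lookup all (∈-lookup {xs = ys} (code mod length ys))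
  ...   | y | y∈ with walk-unique k (code / length ys) (S - y) (nbrs y)
  ...     | u , i = All.map (λ { x∈ refl → x∉p-x S y x∈ }) i ∷ u , y∈ ∷ All.map (p─q⊆p S ⁅ y ⁆) i

  -- Soundness of the search.

  module Soundness (G : Graph n) (complete : ∀ {x y} → Adj G x y → y ∈ nbrs x) where

    -- As an inner vertex of the trail, `w` would have two distinct neighbours in `S`, while `Dead`
    -- leaves it at most one.
    dead-last : ∀ {S c w xs} → Trail G S c xs → Dead S c w → w ∈ c ∷ xs → w ≡ lastOf c xs
    dead-last t (_ , w≢c , _) (here w≡c) = contradiction w≡c w≢c
    dead-last {S} t (_ , _ , few) (there w∈) with inner-neighbours t w∈
    ... | inj₁ eq = eq
    ... | inj₂ (p , q , p∈ , q∈ , p≢q , pw , wq) = contradiction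
      (at-most-one few (free p∈ (complete (Adj-sym G pw))) (free q∈ (complete wq))) p≢q
      where
      free : ∀ {p} → p ∈ _ → p ∈ nbrs _ → p ∈ filter (_∈ₛ? S) (nbrs _)
      free p∈ wp = ∈-filter⁺ (_∈ₛ? S) wp (All.lookup (Trail.inside t) p∈)

    miss-two : ∀ {S c x y xs} → Trail G S c xs → x ∈ₛ S → y ∈ₛ S → x ≢ y →
               x ∉ c ∷ xs → y ∉ c ∷ xs → 2 + length (c ∷ xs) ≤ ∣ S ∣
    miss-two (trail _ u i) x∈ y∈ x≢y x∉ y∉ =
      Unique-length ((x≢y ∷ ∉⇒All≢ x∉) ∷ ∉⇒All≢ y∉ ∷ u) (x∈ ∷ y∈ ∷ i)

    -- Dead vertices on the trail all coincide with its last vertex, so at most one of the three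
    -- lies on it.
    three-dead : ∀ {S c xs ws} → Trail G S c xs → Unique ws → All (Dead S c) ws →
                 3 ≤ length ws → 2 + length (c ∷ xs) ≤ ∣ S ∣
    three-dead {S} {c} {xs} {x ∷ y ∷ z ∷ _} t ((x≢y ∷ x≢z ∷ _) ∷ (y≢z ∷ _) ∷ _) (dx ∷ dy ∷ dz ∷ _) _ =
      cases (x Member.∈? c ∷ xs) (y Member.∈? c ∷ xs)
      where
      other : ∀ {v w} → Dead S c v → Dead S c w → v ≢ w → v ∈ c ∷ xs → w ∉ c ∷ xs
      other dv dw v≢w v∈ w∈ = v≢w (trans (dead-last t dv v∈) (≡-sym (dead-last t dw w∈)))
      cases : Dec (x ∈ c ∷ xs) → Dec (y ∈ c ∷ xs) → 2 + length (c ∷ xs) ≤ ∣ S ∣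
      cases (yes x∈) _ =
        miss-two t (proj₁ dy) (proj₁ dz) y≢z (other dx dy x≢y x∈) (other dx dz x≢z x∈)
      cases (no x∉) (yes y∈) = miss-two t (proj₁ dx) (proj₁ dz) x≢z x∉ (other dy dz y≢z y∈)
      cases (no x∉) (no y∉)  = miss-two t (proj₁ dx) (proj₁ dy) x≢y x∉ y∉
    three-dead {ws = _ ∷ _ ∷ []} _ _ _ (s≤s (s≤s ()))
    three-dead {ws = _ ∷ []} _ _ _ (s≤s ())
    three-dead {ws = []} _ _ _ ()

    dead-sound : ∀ {S c} ws → Unique (dead S c ws) × All (Dead S c) (dead S c ws)
    dead-sound {S} {c} ws =
      Dedup.deduplicate-! (filter (dead? S c) ws) ,
      All.deduplicate⁺ Fin._≟_ (All.all-filter (dead? S c) ws)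

    -- Each step lowers both `∣ S ∣` and `k` by one, which preserves `∣ S ∣ ≤ 2 + k`. Hence missing
    -- two vertices of `S` means at any depth that at most `k` are visited.
    bounded⇒≤ : ∀ k {S c ws} → Bounded k S c ws → Unique ws × All (Dead S c) ws →
                ∣ S ∣ ≤ 2 + k → ∀ {xs} → Trail G S c xs → length (c ∷ xs) ≤ k
    bounded⇒≤ k (inj₁ 3≤) (u , d) S≤ t =
      s≤s⁻¹ (s≤s⁻¹ (ℕ.≤-trans (three-dead t u d 3≤) S≤))
    bounded⇒≤ (suc k) (inj₂ _) _ S≤ {[]} t = s≤s z≤n
    bounded⇒≤ (suc k) {S} {c} {ws} (inj₂ bs) _ S≤ {y ∷ xs} t with Trail-tail t
    ... | cy , t′@(trail _ _ (y∈ ∷ _)) = s≤s (bounded⇒≤ k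
      (All.lookup bs (complete cy) y∈)
      (dead-sound (ws ++ nbrs c))
      (s≤s⁻¹ (ℕ.<-≤-trans (x∈p⇒∣p-x∣<∣p∣ (All.head (Trail.inside t))) S≤)) t′)

    order-bound : ∀ k → n ≤ 2 + k → (∀ s → Bounded k ⊤ s (dead ⊤ s (allFin n))) →
                  ∀ (P : Path G) → order P ≤ k
    order-bound k n≤ b record { verts = [] } = z≤n
    order-bound k n≤ b record { verts = s ∷ xs ; distinct = u ; linked = l } =
      bounded⇒≤ k (b s) (dead-sound (allFin n)) (subst (_≤ 2 + k) (≡-sym (∣⊤∣≡n n)) n≤)
        (trail l u (All.universal (λ _ → ∈⊤) _))

    noReturn⇒ : ∀ {s} k {S c y xs} → NoReturn s k S c → Trail G S c (y ∷ xs) →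
                length (y ∷ xs) ≤ k → ¬ Adj G (lastOf y xs) s
    noReturn⇒ (suc k) nr t (s≤s xs≤) closes with Trail-tail t
    ... | cy , t′@(trail _ _ (y∈ ∷ _)) with All.lookup nr (complete cy) y∈
    noReturn⇒ (suc k) {xs = []}    nr t _ closes         | _ , _  | s∉ , _   = s∉ (complete closes)
    noReturn⇒ (suc k) {xs = _ ∷ _} nr t (s≤s xs≤) closes | _ , t′ | _  , nr′ = noReturn⇒ k nr′ t′ xs≤ closes

    girth-bound : ∀ k → NoCycle k → ∀ (C : Cycle G) → 3 + k ≤ cycleLength C
    girth-bound k nc record { rest = []     ; long = s≤s () }
    girth-bound k nc record { rest = _ ∷ [] ; long = s≤s (s≤s ()) }
    girth-bound k nc record { start = s ; rest = y ∷ z ∷ xs ; distinct = u ; linked = l ; closes = closes }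
      with Trail-tail (trail l u (All.universal (λ _ → ∈⊤) _))
    -- The vertices `s` and `y` account for the two successors stripped here; the bound `k` concerns
    -- `z ∷ xs`.
    ... | sy , t = ℕ.≰⇒> λ { (s≤s (s≤s ≤k)) →
      noReturn⇒ k (All.lookup (nc s) (complete sy)) t ≤k closes }

-- Saturation from explicit long paths.

LongPath : ∀ {n} → (Fin n → Fin n → Set) → ℕ → List (Fin n) → Set
LongPath R k xs = Unique xs × Linked R xs × k < length xs

module _ {n} (G : Graph n) where

  Longest : ℕ → Set
  Longest k = ∀ (P : Path G) → order P ≤ k

  -- Using `addEdgeAdj` instead of `addEdge` keeps the proof of `u ≢ v` out of the type, so that the
  -- condition can be evaluated for any pair and the ends can be exchanged.
  Lengthens : ℕ → Fin n → Fin n → Set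
  Lengthens k u v = ∃ (LongPath (λ x y → T (addEdgeAdj G u v x y)) k)

  Saturating : ℕ → Set
  Saturating k = ∀ u v → u ≢ v → ¬ Adj G u v → Lengthens k u v

  Reaches : ℕ → Set
  Reaches k = ∀ u → ∃ λ xs → LongPath (Adj G) k (u ∷ xs)

  saturated : ∀ k → Longest k → Saturating k → DetourSaturated G
  saturated k longest saturating u v u≢v ¬uv with saturating u v u≢v ¬uv
  ... | xs , u , l , k< =
    record { verts = xs ; distinct = u ; linked = l } , λ Q → ℕ.≤-<-trans (longest Q) k<

  addEdgeAdj-swap : ∀ u v x y → addEdgeAdj G u v x y ≡ addEdgeAdj G v u x y
  addEdgeAdj-swap u v x y = cong (adj G x y ∨_) (Bool.∨-comm (⌊ x Fin.≟ u ⌋ ∧ ⌊ y Fin.≟ v ⌋) _)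

  Lengthens-swap : ∀ {k u v} → Lengthens k u v → Lengthens k v u
  Lengthens-swap {u = u} {v} (xs , u! , l , k<) =
    xs , u! , Linked.map (λ {x} {y} → subst T (addEdgeAdj-swap u v x y)) l , k<

  -- The added edge has no direction, so a triangular table of paths covers all pairs.
  saturating-from-< : ∀ k → (∀ u v → v Fin.< u → Adj G u v ⊎ Lengthens k u v) → Saturating k
  saturating-from-< k h u v u≢v ¬uv with Fin.<-cmp u v
  ... | tri≈ _ u≡v _ = contradiction u≡v u≢v
  ... | tri> _ _ v<u with h u v v<u
  ...   | inj₁ uv = contradiction uv ¬uv
  ...   | inj₂ p  = p
  saturating-from-< k h u v u≢v ¬uv | tri< u<v _ _ with h v u u<v
  ...   | inj₁ vu = contradiction (Adj-sym G vu) ¬uv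
  ...   | inj₂ p  = Lengthens-swap p

-- Disjoint unions of copies of a graph.

T-∨ˡ : ∀ {a b} → T a → T (a ∨ b)
T-∨ˡ {true} _ = _

addEdgeAdj-new : ∀ {n} (G : Graph n) u v → T (addEdgeAdj G u v u v)
addEdgeAdj-new G u v with u Fin.≟ u | v Fin.≟ v
... | yes _  | yes _  = subst T (≡-sym (Bool.∨-zeroʳ (adj G u v))) _
... | no u≢u | _      = contradiction refl u≢u
... | _      | no v≢v = contradiction refl v≢v

⌊⌋-⇔ : ∀ {A B : Set} → A ⇔ B → (A? : Dec A) (B? : Dec B) → ⌊ A? ⌋ ≡ ⌊ B? ⌋
⌊⌋-⇔ A⇔B A? B? = trans (isYes≗does A?) (trans (does-⇔ A⇔B A? B?) (≡-sym (isYes≗does B?)))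

module Copies {n} (m : ℕ) (G : Graph n) where

  embed : Fin m → Fin n → Fin (m * n)
  embed = combine

  copies : Graph (m * n)
  copies = record
    { adj    = λ x y → does (copy x Fin.≟ copy y) ∧ adj G (local x) (local y)
    ; sym    = λ x y → cong₂ _∧_ (≟-comm (copy x) (copy y)) (Graph.sym G (local x) (local y))
    ; irrefl = λ x → trans (cong (does (copy x Fin.≟ copy x) ∧_) (irrefl G (local x))) (Bool.∧-zeroʳ _)
    }
    where
    copy : Fin (m * n) → Fin m
    copy = quotient n
    local : Fin (m * n) → Fin n
    local = remainder {m} n
    ≟-comm : ∀ (i j : Fin m) → does (i Fin.≟ j) ≡ does (j Fin.≟ i)
    ≟-comm i j = does-⇔ (mk⇔ ≡-sym ≡-sym) (i Fin.≟ j) (j Fin.≟ i)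

  adj-embed : ∀ i j x y → adj copies (embed i x) (embed j y) ≡ does (i Fin.≟ j) ∧ adj G x y
  adj-embed i j x y =
    cong₂ (λ (i , x) (j , y) → does (i Fin.≟ j) ∧ adj G x y) (Fin.remQuot-combine i x) (Fin.remQuot-combine j y)

  Adj-embed⁺ : ∀ {i x y} → Adj G x y → Adj copies (embed i x) (embed i y)
  Adj-embed⁺ {i} {x} {y} xy =
    subst T (≡-sym (trans (adj-embed i i x y) (cong (_∧ adj G x y) (dec-true (i Fin.≟ i) refl)))) xy

  Adj-embed⁻ : ∀ {i j x y} → Adj copies (embed i x) (embed j y) → i ≡ j × Adj G x y
  Adj-embed⁻ {i} {j} {x} {y} xy with i Fin.≟ j | adj-embed i j x y
  ... | yes i≡j | eq = i≡j , subst T eq xy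
  ... | no _    | eq with () ← subst T eq xy

  embed-injective : ∀ i {x y} → embed i x ≡ embed i y → x ≡ y
  embed-injective i {x} {y} = Fin.combine-injectiveʳ i x i y

  Linked-embed⁺ : ∀ {i xs} → Linked (Adj G) xs → Linked (Adj copies) (map (embed i) xs)
  Linked-embed⁺ = Linked.map⁺ ∘ Linked.map Adj-embed⁺

  Linked-embed⁻ : ∀ {i xs} → Linked (Adj copies) (map (embed i) xs) → Linked (Adj G) xs
  Linked-embed⁻ {i} = Linked.map (proj₂ ∘ Adj-embed⁻ {i}) ∘ Linked.map⁻

  -- No edge leaves a copy. Paths and cycles of the union can therefore be pulled back to `G`, which
  -- transfers the bounds on path order and girth.
  Linked⇒local : ∀ {i x xs} → Linked (Adj copies) (embed i x ∷ xs) → ∃ λ ys → xs ≡ map (embed i) ys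
  Linked⇒local {xs = []}     _       = [] , refl
  Linked⇒local {xs = y ∷ ys} (r ∷ l) with Fin.combine-surjective {m} {n} y
  ... | j , z , refl with Adj-embed⁻ r
  ...   | refl , _ with Linked⇒local l
  ...     | zs , refl = z ∷ zs , refl

  longest : ∀ {k} → Longest G k → Longest copies k
  longest b record { verts = [] } = z≤n
  longest {k} b record { verts = x ∷ xs ; distinct = u ; linked = l } with Fin.combine-surjective {m} {n} x
  ... | i , y , refl with Linked⇒local l
  ...   | ys , refl = subst (_≤ k) (≡-sym (length-map (embed i) (y ∷ ys)))
    (b record { verts = y ∷ ys ; distinct = Unique.map⁻ u ; linked = Linked-embed⁻ l })

  lastOf-map : ∀ {A B : Set} (f : A → B) x xs → lastOf (f x) (map f xs) ≡ f (lastOf x xs)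
  lastOf-map f x []       = refl
  lastOf-map f x (y ∷ ys) = lastOf-map f y ys

  girth≥ : ∀ {g} → (∀ (C : Cycle G) → g ≤ cycleLength C) → ∀ (C : Cycle copies) → g ≤ cycleLength C
  girth≥ {g} b record { start = s ; rest = xs ; distinct = u ; linked = l ; closes = c ; long = 3≤ }
    with Fin.combine-surjective {m} {n} s
  ... | i , t , refl with Linked⇒local l
  ...   | ys , refl = subst (g ≤_) (≡-sym len) (b record
    { start = t ; rest = ys ; distinct = Unique.map⁻ u ; linked = Linked-embed⁻ l
    ; closes = proj₂ (Adj-embed⁻ (subst (λ z → Adj copies z (embed i t)) (lastOf-map (embed i) t ys) c))
    ; long = subst (3 ≤_) len 3≤ })
    where
    len : length (map (embed i) (t ∷ ys)) ≡ length (t ∷ ys)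
    len = length-map (embed i) (t ∷ ys)

  embed-cycle : Fin m → (C : Cycle G) → Σ (Cycle copies) λ C′ → cycleLength C′ ≡ cycleLength C
  embed-cycle i record { start = s ; rest = xs ; distinct = u ; linked = l ; closes = c ; long = 3≤ } =
    record
      { start = embed i s ; rest = map (embed i) xs
      ; distinct = Unique.map⁺ (embed-injective i) u ; linked = Linked-embed⁺ l
      ; closes = subst (λ z → Adj copies z (embed i s)) (≡-sym (lastOf-map (embed i) s xs)) (Adj-embed⁺ c)
      ; long = subst (3 ≤_) (≡-sym len) 3≤ } , len
    where
    len : length (map (embed i) (s ∷ xs)) ≡ length (s ∷ xs)
    len = length-map (embed i) (s ∷ xs)

  addEdgeAdj-embed : ∀ {i u v x y} → T (addEdgeAdj G u v x y) →
    T (addEdgeAdj copies (embed i u) (embed i v) (embed i x) (embed i y))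
  addEdgeAdj-embed {i} {u} {v} {x} {y} = subst T (≡-sym (cong₂ _∨_
    (trans (adj-embed i i x y) (cong (_∧ adj G x y) (dec-true (i Fin.≟ i) refl)))
    (cong₂ _∨_ (cong₂ _∧_ (≟-embed x u) (≟-embed y v)) (cong₂ _∧_ (≟-embed x v) (≟-embed y u)))))
    where
    ≟-embed : ∀ x y → ⌊ embed i x Fin.≟ embed i y ⌋ ≡ ⌊ x Fin.≟ y ⌋
    ≟-embed x y = ⌊⌋-⇔ (mk⇔ (embed-injective i) (cong (embed i))) (embed i x Fin.≟ embed i y) (x Fin.≟ y)

  saturating : ∀ {k h} → Saturating G k → Reaches G h → k ≤ h + h → Saturating copies k
  saturating {k} {h} sat reach k≤ u v u≢v ¬uv
    with Fin.combine-surjective {m} {n} u | Fin.combine-surjective {m} {n} v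
  ... | i , a , refl | j , b , refl with i Fin.≟ j
  ...   | yes refl with sat a b (u≢v ∘ cong (embed i)) (¬uv ∘ Adj-embed⁺)
  ...     | xs , u! , l , k< =
    map (embed i) xs , Unique.map⁺ (embed-injective i) u! ,
    Linked.map⁺ (Linked.map addEdgeAdj-embed l) , subst (k <_) (≡-sym (length-map (embed i) xs)) k<
  saturating {k} {h} sat reach k≤ _ _ u≢v ¬uv | i , a , refl | j , b , refl | no i≢j
    with reach a | reach b
  ... | xs , xs! , xsl , h<xs | ys , ys! , ysl , h<ys =
    -- The path from `a` is reversed so that it ends at the new edge, where the path from `b`
    -- begins.
    as ʳ++ bs ,
    Unique-ʳ++ (Unique.map⁺ (embed-injective i) xs!) (Unique.map⁺ (embed-injective j) ys!) disjoint ,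
    Linked-ʳ++ (λ {x} {y} → Adj-sym H {x} {y}) (map (embed i) xs) (addEdgeAdj-new copies (embed i a) (embed j b))
      (Linked.map T-∨ˡ (Linked-embed⁺ xsl)) (Linked.map T-∨ˡ (Linked-embed⁺ ysl)) ,
    subst (k <_) (≡-sym len) (ℕ.≤-<-trans k≤ (ℕ.+-mono-< h<xs h<ys))
    where
    H : Graph (m * n)
    H = addEdge copies (embed i a) (embed j b) u≢v
    as bs : List (Fin (m * n))
    as = map (embed i) (a ∷ xs)
    bs = map (embed j) (b ∷ ys)
    disjoint : Disjoint as bs
    disjoint (v∈as , v∈bs) with ∈-map⁻ (embed i) v∈as | ∈-map⁻ (embed j) v∈bs
    ... | x , _ , refl | y , _ , eq = i≢j (Fin.combine-injectiveˡ i x j y eq)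
    len : length (as ʳ++ bs) ≡ length (a ∷ xs) + length (b ∷ ys)
    len = trans (length-ʳ++ as) (cong₂ _+_ (length-map (embed i) (a ∷ xs)) (length-map (embed j) (b ∷ ys)))

open Copies using (copies)

-- Taking `suc i` copies ensures that there is a copy to contain the shortest cycle. Isomorphic
-- members have equal orders, and the nonzero factor `suc n` cancels.
copies-family : ∀ {n} (G : Graph (suc n)) k h g →
  Longest G k → Saturating G k → Reaches G h → k ≤ h + h → HasGirth G g →
  Σ (ℕ → AnyGraph) λ F →
    (∀ i → DetourSaturated (AnyGraph.graph (F i)) × HasGirth (AnyGraph.graph (F i)) g)
    × (∀ i j → i ≢ j → ¬ Isomorphic (AnyGraph.graph (F i)) (AnyGraph.graph (F j)))
copies-family {n} G k h g longest saturating reaches k≤ ((C , len) , girth≥) =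
  (λ i → ⟨ suc i * suc n , copies (suc i) G ⟩) ,
  (λ i → let module C = Copies (suc i) G ; (C′ , len′) = C.embed-cycle Fin.zero C in
    saturated C.copies k (C.longest longest) (C.saturating saturating reaches k≤) ,
    (C′ , trans len′ len) , C.girth≥ girth≥) ,
  λ i j i≢j (f , _) → i≢j (ℕ.suc-injective (ℕ.*-cancelʳ-≡ (suc i) (suc j) (suc n) (↔⇒≡ f)))

-- Graphs given by tables of neighbours, with properties checked by evaluation.

module FromTable {n} (nbrs : Fin n → List (Fin n)) where

  open Search nbrs public

  adjacent : Fin n → Fin n → Bool
  adjacent x y = does (y Member.∈? nbrs x)

  IsGraph : Set
  IsGraph = (∀ x y → adjacent x y ≡ adjacent y x) × (∀ x → adjacent x x ≡ false)

  isGraph? : Dec IsGraph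
  isGraph? = Fin.all? (λ x → Fin.all? λ y → adjacent x y Bool.≟ adjacent y x)
       ×-dec Fin.all? (λ x → adjacent x x Bool.≟ false)

  -- The new neighbour comes first, so wherever it is free the digit 0 selects the added edge.
  nbrs+ : Fin n → Fin n → Fin n → List (Fin n)
  nbrs+ u v x = (if does (x Fin.≟ u) then [ v ] else []) ++ (if does (x Fin.≟ v) then [ u ] else []) ++ nbrs x

  module AsGraph (isGraph : IsGraph) where

    graph : Graph n
    graph = record { adj = adjacent ; sym = proj₁ isGraph ; irrefl = proj₂ isGraph }

    Adj⇒∈ : ∀ {x y} → Adj graph x y → y ∈ nbrs x
    Adj⇒∈ {x} {y} xy with y Member.∈? nbrs x
    ... | yes y∈ = y∈

    open Soundness graph (λ {x} {y} → Adj⇒∈ {x} {y}) public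

    adj? : ∀ x y → Dec (Adj graph x y)
    adj? x y = T? (adj graph x y)

    longest : ∀ k → n ≤ 2 + k →
      does (Fin.all? λ s → bounded? k ⊤ s (dead ⊤ s (allFin n))) ≡ true → Longest graph k
    longest k n≤ eq = order-bound k n≤ (holds (Fin.all? λ s → bounded? k ⊤ s (dead ⊤ s (allFin n))) eq)

    IsCycle : Fin n → List (Fin n) → Set
    IsCycle s xs =
      Unique (s ∷ xs) × Linked (Adj graph) (s ∷ xs) × Adj graph (lastOf s xs) s × 3 ≤ length (s ∷ xs)

    isCycle? : ∀ s xs → Dec (IsCycle s xs)
    isCycle? s xs =
      Distinct.unique? (s ∷ xs) ×-dec Linked.linked? adj? (s ∷ xs) ×-dec adj? (lastOf s xs) s ×-dec (3 ≤? _)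

    girth : ∀ k s xs → length (s ∷ xs) ≡ 3 + k → does (noCycle? k ×-dec isCycle? s xs) ≡ true → HasGirth graph (3 + k)
    girth k s xs len eq with holds (noCycle? k ×-dec isCycle? s xs) eq
    ... | nc , u , l , c , 3≤ =
      (record { start = s ; rest = xs ; distinct = u ; linked = l ; closes = c ; long = 3≤ } , len) , girth-bound k nc

    long? : ∀ {R : Fin n → Fin n → Set} → (∀ x y → Dec (R x y)) → ∀ k xs → Dec (Linked R xs × k < length xs)
    long? R? k xs = Linked.linked? R? xs ×-dec (k <? length xs)

    codedPath : (Fin n → Fin n → ℕ) → Fin n → Fin n → List (Fin n)
    -- With all vertices as first candidates, the first digit has radix `n` and names the starting
    -- vertex.
    codedPath code u v = Search.walk (nbrs+ u v) n (code u v) ⊤ (allFin n)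

    coded? : ∀ k code → Dec (∀ u v → v Fin.< u → Adj graph u v ⊎
      Linked (λ x y → T (addEdgeAdj graph u v x y)) (codedPath code u v) × k < length (codedPath code u v))
    coded? k code = Fin.all? λ u → Fin.all? λ v → v Fin.<? u →-dec
      (adj? u v ⊎-dec long? (λ x y → T? (addEdgeAdj graph u v x y)) k (codedPath code u v))

    saturating : ∀ k code → does (coded? k code) ≡ true → Saturating graph k
    saturating k code eq = saturating-from-< graph k λ u v v<u →
      Sum.map₂ (λ (l , k<) → _ , proj₁ (Search.walk-unique (nbrs+ u v) n (code u v) ⊤ (allFin n)) , l , k<)
        (holds (coded? k code) eq u v v<u)

    pathFrom : Fin n → ℕ → List (Fin n)
    pathFrom u code = u ∷ walk n code (⊤ - u) (nbrs u)

    pathFrom? : ∀ k codes →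
      Dec (∀ u → Any (λ c → Linked (Adj graph) (pathFrom u c) × k < length (pathFrom u c)) codes)
    pathFrom? k codes = Fin.all? λ u → any? (λ c → long? adj? k (pathFrom u c)) codes

    reaches : ∀ k codes → does (pathFrom? k codes) ≡ true → Reaches graph k
    reaches k codes eq u with satisfied (holds (pathFrom? k codes) eq u)
    ... | c , l , k< with walk-unique n c (⊤ - u) (nbrs u)
    ...   | w! , w∈ = _ , All.map (λ { x∈ refl → x∉p-x ⊤ u x∈ }) w∈ ∷ w! , l , k<

-- The graphs obtained from the Coxeter graph and the flower snark.

vertices : List ℕ → List (Fin 30)
vertices = map (_mod 30)

entry : List (List ℕ) → Fin 30 → Fin 30 → ℕ
entry table i j = fromMaybe 0 (head (drop (toℕ j) (fromMaybe [] (head (drop (toℕ i) table)))))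

-- In both graphs, star i < 7 of the cubic graph has centre i and arms 7 + i, 14 + i, 21 + i; the
-- centre 0 is replaced by the leaves 0, 28, 29. The Coxeter graph joins equal arms of the stars i and
-- i + 1, of i and i + 2, and of i and i + 3 (mod 7) respectively.
coxeterNbrs : Vec (List (Fin 30)) 30
coxeterNbrs = Vec.map vertices (Vec.fromList (
  (7 ∷ []) ∷ (8 ∷ 15 ∷ 22 ∷ []) ∷ (9 ∷ 16 ∷ 23 ∷ []) ∷ (10 ∷ 17 ∷ 24 ∷ []) ∷
  (11 ∷ 18 ∷ 25 ∷ []) ∷ (12 ∷ 19 ∷ 26 ∷ []) ∷ (13 ∷ 20 ∷ 27 ∷ []) ∷ (0 ∷ 8 ∷ 13 ∷ []) ∷
  (1 ∷ 7 ∷ 9 ∷ []) ∷ (2 ∷ 8 ∷ 10 ∷ []) ∷ (3 ∷ 9 ∷ 11 ∷ []) ∷ (4 ∷ 10 ∷ 12 ∷ []) ∷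
  (5 ∷ 11 ∷ 13 ∷ []) ∷ (6 ∷ 7 ∷ 12 ∷ []) ∷ (16 ∷ 19 ∷ 28 ∷ []) ∷ (1 ∷ 17 ∷ 20 ∷ []) ∷
  (2 ∷ 14 ∷ 18 ∷ []) ∷ (3 ∷ 15 ∷ 19 ∷ []) ∷ (4 ∷ 16 ∷ 20 ∷ []) ∷ (5 ∷ 14 ∷ 17 ∷ []) ∷
  (6 ∷ 15 ∷ 18 ∷ []) ∷ (24 ∷ 25 ∷ 29 ∷ []) ∷ (1 ∷ 25 ∷ 26 ∷ []) ∷ (2 ∷ 26 ∷ 27 ∷ []) ∷
  (3 ∷ 21 ∷ 27 ∷ []) ∷ (4 ∷ 21 ∷ 22 ∷ []) ∷ (5 ∷ 22 ∷ 23 ∷ []) ∷ (6 ∷ 23 ∷ 24 ∷ []) ∷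
  (14 ∷ []) ∷ (21 ∷ []) ∷ []))

-- Entry v of row u > v encodes a path on 29 vertices in the graph with the edge uv added; it is an
-- unused 0 if u and v are adjacent.
coxeterCodes : List (List ℕ)
coxeterCodes =
  ([]) ∷
  (778 ∷ []) ∷
  (1078 ∷ 17460 ∷ []) ∷
  (508 ∷ 59940 ∷ 21060 ∷ []) ∷
  (778 ∷ 25199 ∷ 1530 ∷ 3838 ∷ []) ∷
  (928 ∷ 30600 ∷ 1918 ∷ 1500 ∷ 9360 ∷ []) ∷
  (508 ∷ 7650 ∷ 4290 ∷ 6238 ∷ 4290 ∷ 31350 ∷ []) ∷
  (0 ∷ 8370 ∷ 16110 ∷ 14609 ∷ 20430 ∷ 11968 ∷ 17010 ∷ []) ∷
  (598 ∷ 0 ∷ 1888 ∷ 32040 ∷ 4530 ∷ 3689 ∷ 34290 ∷ 0 ∷ []) ∷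
  (598 ∷ 11160 ∷ 0 ∷ 12960 ∷ 14818 ∷ 450 ∷ 11940 ∷ 32220 ∷ 0 ∷ []) ∷
  (1528 ∷ 1528 ∷ 1888 ∷ 0 ∷ 9180 ∷ 7410 ∷ 6839 ∷ 9720 ∷ 3839 ∷ 0 ∷ []) ∷
  (118 ∷ 22169 ∷ 29009 ∷ 12960 ∷ 0 ∷ 5758 ∷ 7678 ∷ 21088 ∷ 11700 ∷ 19498 ∷ 0 ∷ []) ∷
  (598 ∷ 24958 ∷ 12030 ∷ 25230 ∷ 1500 ∷ 0 ∷ 13050 ∷ 5638 ∷ 3808 ∷ 23130 ∷ 5788 ∷ 0 ∷ []) ∷
  (1888 ∷ 20010 ∷ 1888 ∷ 13170 ∷ 4170 ∷ 5758 ∷ 0 ∷ 0 ∷ 22528 ∷ 4378 ∷ 5278 ∷ 11578 ∷ 0 ∷ []) ∷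
  (1648 ∷ 3809 ∷ 3810 ∷ 3810 ∷ 24540 ∷ 12808 ∷ 21119 ∷ 25200 ∷ 1919 ∷ 30720 ∷ 1919 ∷ 13169 ∷
   43919 ∷ 20100 ∷ []) ∷
  (1078 ∷ 0 ∷ 9088 ∷ 8490 ∷ 18930 ∷ 8730 ∷ 30299 ∷ 3419 ∷ 810 ∷ 18360 ∷ 14908 ∷ 1980 ∷ 13230 ∷
   4140 ∷ 7498 ∷ []) ∷
  (598 ∷ 1438 ∷ 0 ∷ 18150 ∷ 958 ∷ 8400 ∷ 37650 ∷ 3839 ∷ 11908 ∷ 12599 ∷ 36450 ∷ 5850 ∷ 11580 ∷
   4530 ∷ 0 ∷ 41790 ∷ []) ∷
  (749 ∷ 4230 ∷ 9599 ∷ 0 ∷ 13439 ∷ 3600 ∷ 13530 ∷ 37559 ∷ 23250 ∷ 9118 ∷ 11008 ∷ 4740 ∷ 23759 ∷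
   1919 ∷ 38879 ∷ 0 ∷ 3780 ∷ []) ∷
  (1078 ∷ 2010 ∷ 3810 ∷ 5820 ∷ 0 ∷ 46770 ∷ 23250 ∷ 7920 ∷ 11160 ∷ 19290 ∷ 4770 ∷ 4138 ∷ 7259 ∷
   5610 ∷ 29819 ∷ 21240 ∷ 0 ∷ 3839 ∷ []) ∷
  (868 ∷ 37138 ∷ 2848 ∷ 37440 ∷ 17880 ∷ 0 ∷ 5638 ∷ 5369 ∷ 13408 ∷ 6990 ∷ 20789 ∷ 5820 ∷ 4350 ∷
   4018 ∷ 0 ∷ 3150 ∷ 3660 ∷ 0 ∷ 1950 ∷ []) ∷
  (1078 ∷ 48420 ∷ 13020 ∷ 54900 ∷ 1918 ∷ 1078 ∷ 0 ∷ 3629 ∷ 810 ∷ 10500 ∷ 3868 ∷ 28140 ∷ 6809 ∷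
   4140 ∷ 3358 ∷ 0 ∷ 2880 ∷ 4230 ∷ 0 ∷ 6720 ∷ []) ∷
  (718 ∷ 36328 ∷ 1918 ∷ 16890 ∷ 1918 ∷ 35730 ∷ 5638 ∷ 14818 ∷ 1888 ∷ 45268 ∷ 17129 ∷ 25438 ∷
   1918 ∷ 5758 ∷ 26340 ∷ 1380 ∷ 6180 ∷ 29370 ∷ 29760 ∷ 5700 ∷ 1410 ∷ []) ∷
  (598 ∷ 0 ∷ 19198 ∷ 11280 ∷ 24118 ∷ 11280 ∷ 598 ∷ 6058 ∷ 10050 ∷ 12960 ∷ 1918 ∷ 35130 ∷ 1500 ∷
   33960 ∷ 9360 ∷ 810 ∷ 15810 ∷ 2160 ∷ 32308 ∷ 14670 ∷ 34588 ∷ 10050 ∷ []) ∷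
  (1078 ∷ 4050 ∷ 0 ∷ 1290 ∷ 17250 ∷ 450 ∷ 450 ∷ 8068 ∷ 5758 ∷ 450 ∷ 11699 ∷ 90 ∷ 5788 ∷ 10560 ∷
   2160 ∷ 11970 ∷ 7619 ∷ 4050 ∷ 30720 ∷ 3689 ∷ 1078 ∷ 11038 ∷ 2370 ∷ []) ∷
  (384 ∷ 3780 ∷ 11730 ∷ 0 ∷ 17098 ∷ 29459 ∷ 6839 ∷ 3808 ∷ 1919 ∷ 23969 ∷ 6839 ∷ 5699 ∷ 1919 ∷
   6720 ∷ 1530 ∷ 33479 ∷ 8758 ∷ 90 ∷ 7650 ∷ 12089 ∷ 3780 ∷ 0 ∷ 7619 ∷ 450 ∷ []) ∷
  (1589 ∷ 3780 ∷ 4529 ∷ 4318 ∷ 0 ∷ 19410 ∷ 6838 ∷ 4378 ∷ 1889 ∷ 3658 ∷ 4019 ∷ 4138 ∷ 1889 ∷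
   13380 ∷ 1500 ∷ 4588 ∷ 12780 ∷ 8400 ∷ 1589 ∷ 4738 ∷ 2010 ∷ 0 ∷ 0 ∷ 55080 ∷ 90 ∷ []) ∷
  (868 ∷ 3928 ∷ 13079 ∷ 13348 ∷ 5700 ∷ 0 ∷ 18809 ∷ 868 ∷ 10410 ∷ 14730 ∷ 13560 ∷ 7498 ∷ 2340 ∷
   15420 ∷ 13199 ∷ 1528 ∷ 30030 ∷ 5850 ∷ 1950 ∷ 3660 ∷ 6720 ∷ 33509 ∷ 0 ∷ 0 ∷ 4290 ∷ 1589 ∷ []) ∷
  (1078 ∷ 15270 ∷ 7948 ∷ 11188 ∷ 4049 ∷ 19168 ∷ 0 ∷ 19228 ∷ 1888 ∷ 1530 ∷ 15900 ∷ 5728 ∷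
   33869 ∷ 420 ∷ 1950 ∷ 10350 ∷ 14670 ∷ 30269 ∷ 4140 ∷ 1380 ∷ 3508 ∷ 420 ∷ 3810 ∷ 0 ∷ 0 ∷
   5700 ∷ 2340 ∷ []) ∷
  (208 ∷ 1050 ∷ 1500 ∷ 1020 ∷ 1050 ∷ 1500 ∷ 1020 ∷ 1710 ∷ 4590 ∷ 1140 ∷ 750 ∷ 509 ∷ 1080 ∷
   420 ∷ 0 ∷ 4289 ∷ 1050 ∷ 540 ∷ 1530 ∷ 90 ∷ 1530 ∷ 420 ∷ 1500 ∷ 1500 ∷ 90 ∷ 420 ∷ 1080 ∷ 420 ∷
   []) ∷
  (209 ∷ 1890 ∷ 1918 ∷ 1890 ∷ 1740 ∷ 450 ∷ 90 ∷ 868 ∷ 688 ∷ 330 ∷ 450 ∷ 90 ∷ 270 ∷ 0 ∷ 1530 ∷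
   450 ∷ 450 ∷ 90 ∷ 1860 ∷ 3660 ∷ 1860 ∷ 0 ∷ 4678 ∷ 450 ∷ 90 ∷ 90 ∷ 3780 ∷ 3780 ∷ 420 ∷ []) ∷
  []

module Coxeter where

  open FromTable (Vec.lookup coxeterNbrs) using (isGraph?; module AsGraph)
  open AsGraph (holds isGraph? refl) hiding (longest; girth; saturating; reaches) public
  private module G = AsGraph (holds isGraph? refl)

  -- From any start other than the leaves `0`, `28` and `29`, these three are dead at once. Only the
  -- three leaf starts need branching, and there two leaves are dead already, so a branch is cut at
  -- the next dead vertex.
  longest : Longest graph 28
  longest = G.longest 28 ℕ.≤-refl refl

  girth : HasGirth graph 7
  -- The 7-cycle consists of the arms 7 to 13, one from each star.
  girth = G.girth 4 (7 mod 30) (vertices (8 ∷ 9 ∷ 10 ∷ 11 ∷ 12 ∷ 13 ∷ [])) refl refl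

  saturating : Saturating graph 28
  saturating = G.saturating 28 (entry coxeterCodes) refl

-- The arms of J₇ form a cycle 7, …, 13 and a cycle 14, …, 27.
flowerNbrs : Vec (List (Fin 30)) 30
flowerNbrs = Vec.map vertices (Vec.fromList (
  (7 ∷ []) ∷ (8 ∷ 15 ∷ 22 ∷ []) ∷ (9 ∷ 16 ∷ 23 ∷ []) ∷ (10 ∷ 17 ∷ 24 ∷ []) ∷
  (11 ∷ 18 ∷ 25 ∷ []) ∷ (12 ∷ 19 ∷ 26 ∷ []) ∷ (13 ∷ 20 ∷ 27 ∷ []) ∷ (0 ∷ 8 ∷ 13 ∷ []) ∷
  (1 ∷ 7 ∷ 9 ∷ []) ∷ (2 ∷ 8 ∷ 10 ∷ []) ∷ (3 ∷ 9 ∷ 11 ∷ []) ∷ (4 ∷ 10 ∷ 12 ∷ []) ∷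
  (5 ∷ 11 ∷ 13 ∷ []) ∷ (6 ∷ 7 ∷ 12 ∷ []) ∷ (15 ∷ 27 ∷ 28 ∷ []) ∷ (1 ∷ 14 ∷ 16 ∷ []) ∷
  (2 ∷ 15 ∷ 17 ∷ []) ∷ (3 ∷ 16 ∷ 18 ∷ []) ∷ (4 ∷ 17 ∷ 19 ∷ []) ∷ (5 ∷ 18 ∷ 20 ∷ []) ∷
  (6 ∷ 19 ∷ 21 ∷ []) ∷ (20 ∷ 22 ∷ 29 ∷ []) ∷ (1 ∷ 21 ∷ 23 ∷ []) ∷ (2 ∷ 22 ∷ 24 ∷ []) ∷
  (3 ∷ 23 ∷ 25 ∷ []) ∷ (4 ∷ 24 ∷ 26 ∷ []) ∷ (5 ∷ 25 ∷ 27 ∷ []) ∷ (6 ∷ 14 ∷ 26 ∷ []) ∷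
  (14 ∷ []) ∷ (21 ∷ []) ∷ []))

-- The encoding is that of `coxeterCodes`, but a 0 can also be a genuine code, as for the
-- non-adjacent pair 1, 0: start at vertex 0 and always take the first free neighbour.
flowerCodes : List (List ℕ)
flowerCodes =
  ([]) ∷
  (0 ∷ []) ∷
  (1018 ∷ 1500 ∷ []) ∷
  (208 ∷ 68700 ∷ 720 ∷ []) ∷
  (180 ∷ 60 ∷ 1650 ∷ 450 ∷ []) ∷
  (778 ∷ 1440 ∷ 3600 ∷ 12988 ∷ 510 ∷ []) ∷
  (209 ∷ 34620 ∷ 390 ∷ 2160 ∷ 6810 ∷ 90 ∷ []) ∷
  (0 ∷ 52650 ∷ 1080 ∷ 14278 ∷ 5729 ∷ 270 ∷ 39690 ∷ []) ∷
  (58 ∷ 0 ∷ 9358 ∷ 1260 ∷ 450 ∷ 26430 ∷ 1470 ∷ 0 ∷ []) ∷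
  (28 ∷ 51719 ∷ 0 ∷ 43200 ∷ 240 ∷ 1468 ∷ 11940 ∷ 98729 ∷ 0 ∷ []) ∷
  (779 ∷ 30 ∷ 1678 ∷ 0 ∷ 5070 ∷ 3090 ∷ 5790 ∷ 13799 ∷ 8850 ∷ 0 ∷ []) ∷
  (238 ∷ 11940 ∷ 720 ∷ 12480 ∷ 0 ∷ 4559 ∷ 240 ∷ 4438 ∷ 3960 ∷ 39868 ∷ 0 ∷ []) ∷
  (29 ∷ 37890 ∷ 1469 ∷ 1170 ∷ 35790 ∷ 0 ∷ 43558 ∷ 67528 ∷ 209 ∷ 49078 ∷ 37530 ∷ 0 ∷ []) ∷
  (58 ∷ 0 ∷ 23220 ∷ 508 ∷ 1830 ∷ 12239 ∷ 0 ∷ 0 ∷ 26460 ∷ 6720 ∷ 8100 ∷ 50100 ∷ 0 ∷ []) ∷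
  (2279 ∷ 24420 ∷ 5730 ∷ 12330 ∷ 22169 ∷ 90 ∷ 42058 ∷ 82679 ∷ 30 ∷ 24479 ∷ 6450 ∷ 23519 ∷
   53010 ∷ 240 ∷ []) ∷
  (568 ∷ 0 ∷ 9330 ∷ 720 ∷ 450 ∷ 12180 ∷ 90 ∷ 0 ∷ 70290 ∷ 0 ∷ 8878 ∷ 2880 ∷ 90 ∷ 42420 ∷ 0 ∷ []) ∷
  (360 ∷ 24420 ∷ 0 ∷ 39360 ∷ 2370 ∷ 3028 ∷ 3330 ∷ 27450 ∷ 30 ∷ 37860 ∷ 30 ∷ 12480 ∷ 19170 ∷
   508 ∷ 36300 ∷ 0 ∷ []) ∷
  (778 ∷ 60 ∷ 24690 ∷ 0 ∷ 46530 ∷ 3540 ∷ 5250 ∷ 360 ∷ 1198 ∷ 240 ∷ 47730 ∷ 240 ∷ 16590 ∷ 8820 ∷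
   7650 ∷ 31890 ∷ 0 ∷ []) ∷
  (1649 ∷ 9300 ∷ 1890 ∷ 44820 ∷ 0 ∷ 27540 ∷ 570 ∷ 4770 ∷ 25650 ∷ 8640 ∷ 30 ∷ 50580 ∷ 30 ∷
   4079 ∷ 810 ∷ 25198 ∷ 58708 ∷ 0 ∷ []) ∷
  (0 ∷ 15420 ∷ 5250 ∷ 2160 ∷ 47310 ∷ 0 ∷ 18690 ∷ 40410 ∷ 210 ∷ 1500 ∷ 5070 ∷ 240 ∷ 32189 ∷
   240 ∷ 17730 ∷ 1078 ∷ 8970 ∷ 85770 ∷ 0 ∷ []) ∷
  (148 ∷ 540 ∷ 9330 ∷ 14908 ∷ 450 ∷ 12180 ∷ 0 ∷ 0 ∷ 42959 ∷ 1468 ∷ 6599 ∷ 27060 ∷ 30 ∷ 11700 ∷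
   90 ∷ 16139 ∷ 3840 ∷ 27749 ∷ 34740 ∷ 0 ∷ []) ∷
  (778 ∷ 55019 ∷ 60 ∷ 83459 ∷ 5730 ∷ 7620 ∷ 18690 ∷ 111958 ∷ 30 ∷ 61620 ∷ 5970 ∷ 17728 ∷
   18718 ∷ 240 ∷ 67260 ∷ 540 ∷ 23460 ∷ 2220 ∷ 22980 ∷ 5820 ∷ 0 ∷ []) ∷
  (209 ∷ 0 ∷ 8850 ∷ 720 ∷ 10289 ∷ 11700 ∷ 209 ∷ 269 ∷ 70290 ∷ 4560 ∷ 24209 ∷ 2640 ∷ 958 ∷
   42420 ∷ 3780 ∷ 101010 ∷ 1410 ∷ 17038 ∷ 26880 ∷ 3810 ∷ 81209 ∷ 0 ∷ []) ∷
  (539 ∷ 23460 ∷ 0 ∷ 50340 ∷ 420 ∷ 9540 ∷ 23488 ∷ 50518 ∷ 3808 ∷ 37860 ∷ 2130 ∷ 39300 ∷ 19170 ∷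
   6720 ∷ 24420 ∷ 539 ∷ 50460 ∷ 60 ∷ 40439 ∷ 2370 ∷ 7620 ∷ 35370 ∷ 0 ∷ []) ∷
  (778 ∷ 1260 ∷ 31918 ∷ 0 ∷ 49438 ∷ 3060 ∷ 4290 ∷ 2279 ∷ 1198 ∷ 4199 ∷ 47250 ∷ 720 ∷ 4950 ∷
   10740 ∷ 12898 ∷ 1678 ∷ 1890 ∷ 47278 ∷ 330 ∷ 1378 ∷ 8159 ∷ 2220 ∷ 40050 ∷ 0 ∷ []) ∷
  (778 ∷ 22980 ∷ 10320 ∷ 44820 ∷ 0 ∷ 34799 ∷ 1770 ∷ 2758 ∷ 25170 ∷ 8640 ∷ 2130 ∷ 50100 ∷ 510 ∷
   4079 ∷ 810 ∷ 31198 ∷ 8819 ∷ 3210 ∷ 50100 ∷ 420 ∷ 4559 ∷ 21568 ∷ 2640 ∷ 43679 ∷ 0 ∷ []) ∷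
  (178 ∷ 15660 ∷ 4290 ∷ 5220 ∷ 41878 ∷ 0 ∷ 17730 ∷ 21239 ∷ 90 ∷ 1500 ∷ 35010 ∷ 1770 ∷ 32189 ∷
   540 ∷ 6060 ∷ 90 ∷ 2280 ∷ 35010 ∷ 450 ∷ 31829 ∷ 90 ∷ 5820 ∷ 2849 ∷ 3330 ∷ 37558 ∷ 0 ∷ []) ∷
  (268 ∷ 1168 ∷ 8850 ∷ 30299 ∷ 510 ∷ 11700 ∷ 0 ∷ 268 ∷ 12208 ∷ 3419 ∷ 6270 ∷ 27060 ∷ 510 ∷
   11700 ∷ 0 ∷ 42420 ∷ 508 ∷ 8128 ∷ 19919 ∷ 2578 ∷ 42420 ∷ 1860 ∷ 18028 ∷ 6180 ∷ 6270 ∷ 34799 ∷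
   0 ∷ []) ∷
  (60 ∷ 30 ∷ 1590 ∷ 450 ∷ 510 ∷ 90 ∷ 240 ∷ 0 ∷ 30 ∷ 60 ∷ 90 ∷ 240 ∷ 90 ∷ 240 ∷ 0 ∷ 90 ∷ 90 ∷
   60 ∷ 90 ∷ 420 ∷ 2310 ∷ 540 ∷ 2310 ∷ 539 ∷ 810 ∷ 810 ∷ 90 ∷ 3780 ∷ []) ∷
  (60 ∷ 30 ∷ 60 ∷ 1380 ∷ 2280 ∷ 1860 ∷ 240 ∷ 0 ∷ 30 ∷ 60 ∷ 30 ∷ 420 ∷ 90 ∷ 240 ∷ 90 ∷ 658 ∷
   508 ∷ 540 ∷ 330 ∷ 540 ∷ 90 ∷ 0 ∷ 3780 ∷ 540 ∷ 1890 ∷ 1500 ∷ 90 ∷ 510 ∷ 810 ∷ []) ∷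
  []

module Flower where

  open FromTable (Vec.lookup flowerNbrs) using (isGraph?; module AsGraph)
  open AsGraph (holds isGraph? refl) hiding (longest; girth; saturating; reaches) public
  private module G = AsGraph (holds isGraph? refl)

  longest : Longest graph 28
  longest = G.longest 28 ℕ.≤-refl refl

  girth : HasGirth graph 6
  -- The 6-cycle passes through the centres 1 and 2 of two consecutive stars and two arms of each.
  girth = G.girth 3 (1 mod 30) (vertices (8 ∷ 9 ∷ 2 ∷ 16 ∷ 15 ∷ [])) refl refl

  saturating : Saturating graph 28
  saturating = G.saturating 28 (entry flowerCodes) refl

  reaches : Reaches graph 14
  -- The codes 0 to 7 vary only the first few branchings; once a code is used up, the walk takes the
  -- first free neighbour. Two paths on at least 15 vertices together exceed 28.
  reaches = G.reaches 14 (upTo 8) refl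

theorem4 : (Σ (ℕ → AnyGraph) λ F →
    (∀ i → DetourSaturated (AnyGraph.graph (F i)) × HasGirth (AnyGraph.graph (F i)) 6)
    × (∀ i j → i ≢ j → ¬ Isomorphic (AnyGraph.graph (F i)) (AnyGraph.graph (F j))))
    × (Σ (Graph 30) λ G → DetourSaturated G × HasGirth G 7)
theorem4 =
  copies-family Flower.graph 28 14 6 Flower.longest Flower.saturating Flower.reaches ℕ.≤-refl Flower.girth ,
  Coxeter.graph , saturated Coxeter.graph 28 Coxeter.longest Coxeter.saturating , Coxeter.girth
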